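{- Let $G$ be a 3-edge-connected noncomplete graph. Then $pc(G)=2$, and there exists an edge-coloring $c$ of $G$ with 2 colors such that $G$ has the strong property under $c$.
   Context: All graphs are simple, finite and undirected. Let $G$ be a nontrivial connected graph with an edge-coloring $c:E(G)\to\{1,\dots,t\}$ (adjacent edges may receive the same color). A path in $G$ is called proper if no two consecutive edges of the path receive the same color (a single edge is a proper path). The colored graph is proper connected if every pair of distinct vertices is connected by at least one proper path. The proper connection number $pc(G)$ is the smallest number of colors in an edge-coloring of $G$ that makes $G$ proper connected. For an edge-colored path $P=v_1v_2\cdots v_s$ from $v_1$ to $v_s$, let $start(P)=c(v_1v_2)$ be the color of its first edge and $end(P)=c(v_{s-1}v_s)$ the color of its last edge (if $P$ is a single edge $v_1v_s$, then $start(P)=end(P)=c(v_1v_s)$). Let $c$ be an edge-coloring of $G$ that makes $G$ proper connected. $G$ has the strong property under $c$ if for any pair of distinct vertices $u,v\in V(G)$ there exist two proper paths $P_1,P_2$ from $u$ to $v$ (not necessarily disjoint) such that $start(P_1)\neq start(P_2)$ and $end(P_1)\neq end(P_2)$. -}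

module Defs where

open import Data.Fin using (Fin)
open import Data.Fin.Properties using (_≟_)
open import Data.List using (List; []; _∷_; head; last; length)
open import Data.List.Relation.Unary.Any using (Any; any?)
import Data.List.Relation.Unary.Any as Any
open import Data.List.Relation.Unary.Linked using (Linked)
open import Data.List.Relation.Unary.Unique.Propositional using (Unique)
open import Data.Nat using (ℕ; _<_; _≤_)
open import Data.Product using (Σ-syntax; ∃-syntax; _×_; _,_; proj₁)
open import Data.Sum using (_⊎_; swap)
open import Function using (_∘_)
open import Relation.Binary using (Decidable; Irreflexive; Rel; Symmetric)
open import Relation.Binary.Construct.Closure.ReflexiveTransitive using (Star; ε; _◅_)
open import Relation.Binary.PropositionalEquality using (_≡_; _≢_)
open import Relation.Nullary using (¬_; Dec)
open import Relation.Nullary.Decidable using (_×-dec_; _⊎-dec_; ¬?)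
open import Level using (0ℓ)

record Graph (n : ℕ) : Set₁ where
  field
    Adj    : Rel (Fin n) 0ℓ
    adj?   : Decidable Adj
    symm   : Symmetric Adj
    irrefl : Irreflexive _≡_ Adj

open Graph public

Complete : ∀ {n} → Graph n → Set
Complete G = ∀ u v → u ≢ v → Adj G u v

Walk : ∀ {n} → Graph n → Rel (Fin n) 0ℓ
Walk G = Star (Adj G)

vertices : ∀ {n} (G : Graph n) {u v} → Walk G u v → List (Fin n)
vertices G {u} ε       = u ∷ []
vertices G {u} (_ ◅ w) = u ∷ vertices G w

IsPath : ∀ {n} (G : Graph n) {u v} → Walk G u v → Set
IsPath G w = Unique (vertices G w)

Connected : ∀ {n} → Graph n → Set
Connected G = ∀ u v → Walk G u v

-- An edge, presented by one of its two orientations.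
record Edge {n} (G : Graph n) : Set where
  constructor edge
  field
    src tgt  : Fin n
    adjacent : Adj G src tgt

Joins : ∀ {n} {G : Graph n} → Fin n → Fin n → Edge G → Set
Joins u v (edge x y _) = (u ≡ x × v ≡ y) ⊎ (v ≡ x × u ≡ y)

joins? : ∀ {n} {G : Graph n} u v (e : Edge G) → Dec (Joins u v e)
joins? u v (edge x y _) = (u ≟ x ×-dec v ≟ y) ⊎-dec (v ≟ x ×-dec u ≟ y)

deleteEdges : ∀ {n} (G : Graph n) → List (Edge G) → Graph n
deleteEdges G F = record
  { Adj    = λ u v → Adj G u v × ¬ Any (Joins u v) F
  ; adj?   = λ u v → adj? G u v ×-dec ¬? (any? (joins? u v) F)
  ; symm   = λ (a , a∉F) → symm G a , a∉F ∘ Any.map swap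
  ; irrefl = λ u≡v → irrefl G u≡v ∘ proj₁
  }

-- The deleted edge set is given as a list; repetitions are harmless, since
-- the sets with fewer than k elements are exactly those listed by a list of
-- length less than k.
EdgeConnected : ∀ {n} → ℕ → Graph n → Set
EdgeConnected {n} k G =
  1 < n × (∀ (F : List (Edge G)) → length F < k → Connected (deleteEdges G F))

-- color-sym says that the colour depends only on the unordered pair {u , v};
-- applied twice, it also makes the colour independent of the adjacency proof.
record Coloring {n} (G : Graph n) (t : ℕ) : Set where
  field
    color     : ∀ {u v} → Adj G u v → Fin t
    color-sym : ∀ {u v} (e : Adj G u v) (e′ : Adj G v u) → color e ≡ color e′

open Coloring public

module _ {n} {G : Graph n} {t : ℕ} (c : Coloring G t) where

  colors : ∀ {u v} → Walk G u v → List (Fin t)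
  colors ε       = []
  colors (e ◅ w) = color c e ∷ colors w

  IsProper : ∀ {u v} → Walk G u v → Set
  IsProper w = Linked _≢_ (colors w)

  record ProperPath (u v : Fin n) : Set where
    field
      walk     : Walk G u v
      isPath   : IsPath G walk
      isProper : IsProper walk

    -- These are 'nothing' only for the one-vertex path, which does not occur
    -- between distinct vertices.
    start = head (colors walk)
    end   = last (colors walk)

  open ProperPath public

  ProperConnected : Set
  ProperConnected = ∀ u v → u ≢ v → ProperPath u v

  HasStrongProperty : Set
  HasStrongProperty = ProperConnected ×
    (∀ u v → u ≢ v →
      Σ[ P₁ ∈ ProperPath u v ] Σ[ P₂ ∈ ProperPath u v ]
        (start P₁ ≢ start P₂ × end P₁ ≢ end P₂))

-- pc(G) = k
IsProperConnectionNumber : ∀ {n} → Graph n → ℕ → Set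
IsProperConnectionNumber G k =
  (∃[ c ] ProperConnected {G = G} {t = k} c) ×
  (∀ t (c : Coloring G t) → ProperConnected c → k ≤ t)

{-# OPTIONS --safe #-}

-- A bipartition of the vertices with the fewest monochromatic edges splits
-- every cut of G at least in half: otherwise flip one side of the cut.  As the
-- cuts of G have at least three edges, the bichromatic edges form a bipartite
-- 2-edge-connected spanning subgraph H, which has a strongly connected
-- orientation (Robbins).  Colour an edge of H by the side of the bipartition
-- on which its arc starts.  Directed walks then alternate in colour, in either
-- direction of traversal.  A directed path from u to v and a directed path from
-- v to u, traversed backwards, differ in colour at u and at v, since one of
-- them leaves u (enters v) and the other enters u (leaves v).

module Submission where

open import Data.Bool using (Bool; true; false; not; _xor_)
import Data.Bool.Properties as Bool
open import Data.Empty using (⊥; ⊥-elim)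
open import Data.Fin using (Fin; zero; suc; combine; remQuot)
open import Data.Fin.Properties
  using (_≟_; any?; combine-injective; combine-surjective; remQuot-combine)
open import Data.Fin.Subset using (Subset; _∈_; _∉_; _-_; ∣_∣; inside; outside)
  renaming (⊤ to full)
open import Data.Fin.Subset.Properties
  using (_∈?_; drop-there; anySubset?; ∈⊤; p─q⊆p; p─⊥≡p; p⊂q⇒∣p∣<∣q∣;
         x∈p∧x≢y⇒x∈p-y; x∈p⇒∣p-x∣<∣p∣)
open import Data.List using (List; []; _∷_; head; last; length)
open import Data.List.Membership.Propositional using () renaming (_∈_ to _∈ˡ_)
open import Data.List.Relation.Unary.All using ([]; _∷_)
open import Data.List.Relation.Unary.All.Properties using (¬Any⇒All¬)
open import Data.List.Relation.Unary.AllPairs using ([]; _∷_)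
open import Data.List.Relation.Unary.Any using (Any; here; there)
import Data.List.Relation.Unary.Any as Any
open import Data.List.Relation.Unary.Linked using ([]; [-]; _∷_)
open import Data.List.Relation.Unary.Unique.Propositional using (Unique)
open import Data.Maybe using (just)
open import Data.Maybe.Properties using (just-injective)
open import Data.Nat using (ℕ; suc; _+_; _*_; _≤_; _<_; _≤?_; _<?_; z≤n; s≤s)
open import Data.Nat.Induction using (<-wellFounded)
open import Data.Nat.Properties
  using (≤-trans; ≤-reflexive; m≤n⇒m≤1+n; ≮⇒≥; <⇒≱; module ≤-Reasoning)
open import Data.Product using (Σ-syntax; ∃; ∃-syntax; _×_; _,_; proj₁; proj₂; uncurry; swap)
open import Data.Sum using (_⊎_; inj₁; inj₂)
import Data.Sum as Sum
open import Data.Vec using (_∷_; lookup; tabulate; zipWith)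
open import Data.Vec.Properties using ([]=⇒lookup; lookup⇒[]=; lookup∘tabulate; lookup-zipWith)
open import Function using (_∘_; flip; id)
open import Induction.WellFounded using (Acc; acc)
open import Level using (0ℓ)
open import Relation.Binary using (Decidable; Rel; _⇒_)
open import Relation.Binary.Construct.Closure.ReflexiveTransitive as Star
  using (Star; ε; _◅_; _◅◅_; _⋆)
open import Relation.Binary.PropositionalEquality
  using (_≡_; _≢_; refl; sym; trans; cong; subst; subst₂)
open import Relation.Nullary using (¬_; Dec; yes; no; does; contradiction)
open import Relation.Nullary.Decidable using (_×-dec_; ¬?; map′; decidable-stable; dec-true)
open import Defs

private
  variable
    n : ℕ

-- Minimisation by descent; subsets and Booleans.

-- Serves for every extremal choice: reachable sets, orientations and maximum cuts are all found by
-- improving a state while `μ` drops.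
descent : {A : Set} {Good : A → Set} (μ : A → ℕ) →
          (∀ a → Good a ⊎ ∃[ b ] μ b < μ a) → A → ∃ Good
descent {A} {Good} μ improve a = go a (<-wellFounded (μ a))
  where
  go : ∀ a → Acc _<_ (μ a) → ∃ Good
  go a (acc rec) with improve a
  ... | inj₁ good      = a , good
  ... | inj₂ (b , b<a) = go b (rec b<a)

∣p∣≤1+∣p-x∣ : ∀ (p : Subset n) x → ∣ p ∣ ≤ suc ∣ p - x ∣
∣p∣≤1+∣p-x∣ (inside  ∷ p) zero    = ≤-reflexive (cong (suc ∘ ∣_∣) (sym (p─⊥≡p p)))
∣p∣≤1+∣p-x∣ (outside ∷ p) zero    = m≤n⇒m≤1+n (≤-reflexive (cong ∣_∣ (sym (p─⊥≡p p))))
∣p∣≤1+∣p-x∣ (inside  ∷ p) (suc x) = s≤s (∣p∣≤1+∣p-x∣ p x)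
∣p∣≤1+∣p-x∣ (outside ∷ p) (suc x) = ∣p∣≤1+∣p-x∣ p x

x∉p-x : ∀ (p : Subset n) x → x ∉ p - x
x∉p-x (s ∷ p) zero    ()
x∉p-x (s ∷ p) (suc x) x∈ = x∉p-x p x (drop-there x∈)

∉⇒lookup : ∀ {S : Subset n} {x} → x ∉ S → lookup S x ≡ outside
∉⇒lookup {S = S} {x} x∉S = Bool.¬-not (x∉S ∘ lookup⇒[]= x S)

xor-cancelʳ : ∀ {x y} z → x xor z ≡ y xor z → x ≡ y
xor-cancelʳ {x} {y} false eq =
  trans (sym (Bool.xor-identityʳ x)) (trans eq (Bool.xor-identityʳ y))
xor-cancelʳ {x} {y} true  eq = Bool.not-injective
  (trans (Bool.xor-comm true x) (trans eq (Bool.xor-comm y true)))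

-- Sets of ordered pairs

-- A relation encoded as a subset of `n * n` has a cardinality to descend on.
record Pairs (n : ℕ) : Set where
  constructor ⟨_⟩
  field
    set : Subset (n * n)

open Pairs

infix 4 _∋_⟶_

-- The wrapper lets unification recover the endpoints, which `combine x y` would hide.
record _∋_⟶_ (D : Pairs n) (x y : Fin n) : Set where
  constructor member
  field
    isMember : combine x y ∈ set D

size : Pairs n → ℕ
size D = ∣ set D ∣

_∋_⟶?_ : ∀ (D : Pairs n) x y → Dec (D ∋ x ⟶ y)
D ∋ x ⟶? y = map′ member _∋_⟶_.isMember (combine x y ∈? set D)

pairs : {R : Rel (Fin n) 0ℓ} → Decidable R → Pairs n
pairs {n} R? = ⟨ tabulate (does ∘ uncurry R? ∘ remQuot {n} n) ⟩

module _ {R : Rel (Fin n) 0ℓ} (R? : Decidable R) where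

  private
    lookup-pairs : ∀ x y → lookup (set (pairs R?)) (combine x y) ≡ does (R? x y)
    lookup-pairs x y = trans
      (lookup∘tabulate (does ∘ uncurry R? ∘ remQuot {n} n) (combine x y))
      (cong (does ∘ uncurry R?) (remQuot-combine x y))

  pairs⁺ : ∀ {x y} → R x y → pairs R? ∋ x ⟶ y
  pairs⁺ {x} {y} r = member (lookup⇒[]= _ _ (trans (lookup-pairs x y) (dec-true (R? x y) r)))

  pairs⁻ : ∀ {x y} → pairs R? ∋ x ⟶ y → R x y
  pairs⁻ {x} {y} (member xy) with R? x y | trans (sym (lookup-pairs x y)) ([]=⇒lookup xy)
  ... | yes r | _ = r

remove : Pairs n → Fin n → Fin n → Pairs n
remove D u v = ⟨ set D - combine u v ⟩

remove⁺ : ∀ (D : Pairs n) {u v x y} → D ∋ x ⟶ y → ¬ (x ≡ u × y ≡ v) → remove D u v ∋ x ⟶ y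
remove⁺ D {u} {v} {x} {y} (member xy) ≢uv =
  member (x∈p∧x≢y⇒x∈p-y xy (≢uv ∘ combine-injective x y u v))

remove⁻ : ∀ (D : Pairs n) {u v x y} → remove D u v ∋ x ⟶ y → D ∋ x ⟶ y × ¬ (x ≡ u × y ≡ v)
remove⁻ D {u} {v} (member xy) =
  member (p─q⊆p (set D) _ xy) , λ { (refl , refl) → x∉p-x (set D) (combine u v) xy }

size-remove-< : ∀ (D : Pairs n) {u v} → D ∋ u ⟶ v → size (remove D u v) < size D
size-remove-< D (member uv) = x∈p⇒∣p-x∣<∣p∣ uv

size-remove-≥ : ∀ (D : Pairs n) u v → size D ≤ suc (size (remove D u v))
size-remove-≥ D u v = ∣p∣≤1+∣p-x∣ (set D) (combine u v)

size-mono-< : ∀ (D E : Pairs n) → (∀ {x y} → D ∋ x ⟶ y → E ∋ x ⟶ y) →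
              ∀ {x y} → E ∋ x ⟶ y → ¬ D ∋ x ⟶ y → size D < size E
size-mono-< {n} D E D⊆E (member xy∈E) xy∉D =
  p⊂q⇒∣p∣<∣q∣ ((λ {p} → D⊆E′ p) , _ , xy∈E , xy∉D ∘ member)
  where
  D⊆E′ : ∀ p → p ∈ set D → p ∈ set E
  D⊆E′ p p∈D with combine-surjective {n} {n} p
  ... | x , y , refl = _∋_⟶_.isMember (D⊆E (member p∈D))

-- Reachability and the crossing of cuts.

-- `U` holds the vertices not yet known to be reached. It starts as everything but `s` and loses a
-- vertex whenever an `R`-step enters it from outside.
unreached : {R : Rel (Fin n) 0ℓ} → Decidable R → ∀ s →
  ∃[ U ] s ∉ U × (∀ {x} → x ∉ U → Star R s x) × (∀ {x y} → x ∉ U → R x y → y ∉ U)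
unreached {n} {R} R? s =
  let ((U , s∉U , reach) , closed) = descent (∣_∣ ∘ proj₁) improve initial in
  U , s∉U , reach , closed
  where
  State : Set
  State = Σ[ U ∈ Subset n ] s ∉ U × (∀ {x} → x ∉ U → Star R s x)

  initial : State
  initial = full - s , x∉p-x full s , reach
    where
    reach : ∀ {x} → x ∉ full - s → Star R s x
    reach {x} x∉ with x ≟ s
    ... | yes refl = ε
    ... | no  x≢s  = contradiction (x∈p∧x≢y⇒x∈p-y ∈⊤ x≢s) x∉

  improve : (a : State) → (∀ {x y} → x ∉ proj₁ a → R x y → y ∉ proj₁ a) ⊎
                          (Σ[ b ∈ State ] ∣ proj₁ b ∣ < ∣ proj₁ a ∣)
  improve (U , s∉U , reach)
    with any? (λ x → any? (λ y → ¬? (x ∈? U) ×-dec y ∈? U ×-dec R? x y))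
  ... | no  none = inj₁ (λ x∉U r y∈U → none (_ , _ , x∉U , y∈U , r))
  ... | yes (x , y , x∉U , y∈U , r) =
    inj₂ ((U - y , s∉U ∘ p─q⊆p U _ , reach′) , x∈p⇒∣p-x∣<∣p∣ y∈U)
    where
    reach′ : ∀ {z} → z ∉ U - y → Star R s z
    reach′ {z} z∉ with z ≟ y
    ... | yes refl = reach x∉U ◅◅ r ◅ ε
    ... | no  z≢y  = reach (λ z∈U → z∉ (x∈p∧x≢y⇒x∈p-y z∈U z≢y))

crossing : {R : Rel (Fin n) 0ℓ} (S : Subset n) → ∀ {u v} → Star R u v → u ∉ S → v ∈ S →
           ∃[ x ] ∃[ y ] x ∉ S × y ∈ S × R x y
crossing S ε u∉S v∈S = contradiction v∈S u∉S
crossing S (_◅_ {j = w} r rs) u∉S v∈S with w ∈? S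
... | yes w∈S = _ , _ , u∉S , w∈S , r
... | no  w∉S = crossing S rs w∉S v∈S

-- Robbins' theorem

module Robbins {H : Rel (Fin n) 0ℓ} (H? : Decidable H)
  (H-irrefl : ∀ {x} → ¬ H x x)
  -- 2-edge-connectivity in one hypothesis: some edge crosses every cut, and if `uv` is a crossing
  -- edge, there is a second one.
  (cut : ∀ (S : Subset n) {u v} → u ∉ S → v ∈ S →
         ∃[ x ] ∃[ y ] x ∉ S × y ∈ S × H x y × ¬ (x ≡ u × y ≡ v))
  where

  H-connected : ∀ u v → Star H u v
  H-connected u v with unreached H? u
  ... | U , u∉U , reach , closed with v ∈? U
  ...   | no  v∉U = reach v∉U
  ...   | yes v∈U = let (x , y , x∉U , y∈U , h , _) = cut U u∉U v∈U
                    in contradiction y∈U (closed x∉U h)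

  -- Both directions of an edge of H may be present.
  record MixedOrientation : Set where
    field
      arcs      : Pairs n
      sound     : ∀ {x y} → arcs ∋ x ⟶ y → H x y
      total     : ∀ {x y} → H x y → arcs ∋ x ⟶ y ⊎ arcs ∋ y ⟶ x
      connected : ∀ u v → Star (arcs ∋_⟶_) u v

  open MixedOrientation public

  Antisymmetric : MixedOrientation → Set
  Antisymmetric M = ∀ {x y} → arcs M ∋ x ⟶ y → ¬ arcs M ∋ y ⟶ x

  bidirected : MixedOrientation
  bidirected = record
    { arcs      = pairs H?
    ; sound     = pairs⁻ H?
    ; total     = inj₁ ∘ pairs⁺ H?
    ; connected = λ u v → Star.map (pairs⁺ H?) (H-connected u v)
    }

  module _ (M : MixedOrientation) where

    private D = arcs M

    Without : Fin n → Fin n → Rel (Fin n) 0ℓ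
    Without u v x y = D ∋ x ⟶ y × ¬ (x ≡ u × y ≡ v) × ¬ (x ≡ v × y ≡ u)

    without? : ∀ u v → Decidable (Without u v)
    without? u v x y = D ∋ x ⟶? y ×-dec
      ¬? (x ≟ u ×-dec y ≟ v) ×-dec ¬? (x ≟ v ×-dec y ≟ u)

    classify : ∀ u v {x y} → D ∋ x ⟶ y →
               Without u v x y ⊎ (x ≡ u × y ≡ v) ⊎ (x ≡ v × y ≡ u)
    classify u v {x} {y} x⟶y with x ≟ u ×-dec y ≟ v | x ≟ v ×-dec y ≟ u
    ... | yes ≡uv | _       = inj₂ (inj₁ ≡uv)
    ... | no _    | yes ≡vu = inj₂ (inj₂ ≡vu)
    ... | no ≢uv  | no ≢vu  = inj₁ (x⟶y , ≢uv , ≢vu)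

    -- The detour avoids both directions of `uv`, so it survives the removal and replaces the lost
    -- arc in every walk. The arc `v ⟶ u` still represents the edge.
    dropArc : ∀ {u v} → D ∋ v ⟶ u → Star (Without u v) u v → MixedOrientation
    dropArc {u} {v} v⟶u detour = record
      { arcs      = remove D u v
      ; sound     = sound M ∘ proj₁ ∘ remove⁻ D
      ; total     = total′
      ; connected = λ x y → (reroute ⋆) (connected M x y)
      }
      where
      -- Irreflexivity of `H` gives `u ≢ v`, so the removed pair is not the reverse arc itself.
      v⟶u′ : remove D u v ∋ v ⟶ u
      v⟶u′ = remove⁺ D v⟶u λ { (refl , refl) → H-irrefl (sound M v⟶u) }

      keep : ∀ {x y} → D ∋ x ⟶ y → remove D u v ∋ x ⟶ y ⊎ (x ≡ u × y ≡ v)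
      keep {x} {y} x⟶y with x ≟ u ×-dec y ≟ v
      ... | yes ≡uv = inj₂ ≡uv
      ... | no  ≢uv = inj₁ (remove⁺ D x⟶y ≢uv)

      reroute : ∀ {x y} → D ∋ x ⟶ y → Star (remove D u v ∋_⟶_) x y
      reroute x⟶y with keep x⟶y
      ... | inj₁ x⟶y′        = x⟶y′ ◅ ε
      ... | inj₂ (refl , refl) = Star.map (λ (r , ≢uv , _) → remove⁺ D r ≢uv) detour

      total′ : ∀ {x y} → H x y → remove D u v ∋ x ⟶ y ⊎ remove D u v ∋ y ⟶ x
      total′ h with total M h
      total′ h | inj₁ x⟶y with keep x⟶y
      ... | inj₁ x⟶y′         = inj₁ x⟶y′
      ... | inj₂ (refl , refl) = inj₂ v⟶u′
      total′ h | inj₂ y⟶x with keep y⟶x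
      ... | inj₁ y⟶x′         = inj₂ y⟶x′
      ... | inj₂ (refl , refl) = inj₁ v⟶u′

    -- If neither of u and v reaches the other without the edge uv, then every
    -- vertex is reached from exactly one of them, and uv is a bridge of H.
    detour : ∀ u v → Star (Without u v) u v ⊎ Star (Without u v) v u
    detour u v with unreached (without? u v) u | unreached (without? u v) v
    ... | X , u∉X , reachX , closedX | Y , v∉Y , reachY , closedY with v ∈? X | u ∈? Y
    ...   | no  v∉X | _       = inj₁ (reachX v∉X)
    ...   | yes _   | no u∉Y  = inj₂ (reachY u∉Y)
    ...   | yes v∈X | yes u∈Y = ⊥-elim bridge
      where
      -- A passage along `uv` lands at `u` or `v`, which reach themselves; any other arc stays
      -- within the reached region it starts from.
      covered : ∀ {x y} → Star (D ∋_⟶_) x y → x ∉ X ⊎ x ∉ Y → y ∉ X ⊎ y ∉ Y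
      covered ε        x∉ = x∉
      covered (r ◅ rs) x∉ with classify u v r
      ... | inj₁ r′                   = covered rs (Sum.map (flip closedX r′) (flip closedY r′) x∉)
      ... | inj₂ (inj₁ (refl , refl)) = covered rs (inj₂ v∉Y)
      ... | inj₂ (inj₂ (refl , refl)) = covered rs (inj₁ u∉X)

      -- The walk is stopped before its first passage along the edge `uv`, if there is one.
      reaches-end : ∀ {x} → Star (D ∋_⟶_) x u → Star (Without u v) x u ⊎ Star (Without u v) x v
      reaches-end ε        = inj₁ ε
      reaches-end (r ◅ rs) with classify u v r
      ... | inj₁ r′                   = Sum.map (r′ ◅_) (r′ ◅_) (reaches-end rs)
      ... | inj₂ (inj₁ (refl , refl)) = inj₁ ε
      ... | inj₂ (inj₂ (refl , refl)) = inj₂ ε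

      closed⋆ : ∀ {Z} → (∀ {x y} → x ∉ Z → Without u v x y → y ∉ Z) →
                ∀ {x y} → Star (Without u v) x y → x ∉ Z → y ∉ Z
      closed⋆ closed ε        = id
      closed⋆ closed (r ◅ rs) = λ x∉Z → closed⋆ closed rs (closed x∉Z r)

      -- From a vertex reached by both, such a stopped walk would let `v` reach `u` or `u` reach
      -- `v`.
      disjoint : ∀ {x} → x ∉ X → x ∉ Y → ⊥
      disjoint {x} x∉X x∉Y with reaches-end (connected M x u)
      ... | inj₁ x⟶u = closed⋆ closedY x⟶u x∉Y u∈Y
      ... | inj₂ x⟶v = closed⋆ closedX x⟶v x∉X v∈X

      bridge : ⊥
      bridge with cut X u∉X v∈X
      ... | x , y , x∉X , y∈X , h , ≢uv with total M h
      ...   | inj₁ x⟶y with classify u v x⟶y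
      ...     | inj₁ r                 = closedX x∉X r y∈X
      ...     | inj₂ (inj₁ ≡uv)        = ≢uv ≡uv
      ...     | inj₂ (inj₂ (refl , _)) = x∉X v∈X
      bridge | x , y , x∉X , y∈X , h , ≢uv | inj₂ y⟶x with classify u v y⟶x
      ... | inj₂ (inj₁ (refl , _))   = u∉X y∈X
      ... | inj₂ (inj₂ (y≡v , x≡u))  = ≢uv (x≡u , y≡v)
      -- Here the arc runs into the region reached from `u`. Its tail `y` lies outside that region,
      -- hence is reached from `v`, and then so is `x`.
      ... | inj₁ r with covered (connected M u y) (inj₁ u∉X)
      ...   | inj₁ y∉X = y∉X y∈X
      ...   | inj₂ y∉Y = disjoint x∉X (closedY y∉Y r)

    -- For an edge present in both directions, `detour` tells which of the two arcs can be spared.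
    orientEdge : Antisymmetric M ⊎ ∃[ M′ ] size (arcs M′) < size D
    orientEdge with any? (λ u → any? (λ v → D ∋ u ⟶? v ×-dec D ∋ v ⟶? u))
    ... | no  none                  = inj₁ (λ x⟶y y⟶x → none (_ , _ , x⟶y , y⟶x))
    ... | yes (u , v , u⟶v , v⟶u) with detour u v
    ...   | inj₁ w = inj₂ (dropArc v⟶u w , size-remove-< D u⟶v)
    ...   | inj₂ w = inj₂ (dropArc u⟶v (Star.map (λ (r , ≢uv , ≢vu) → r , ≢vu , ≢uv) w)
                          , size-remove-< D v⟶u)

  strongOrientation : ∃ Antisymmetric
  strongOrientation = descent (size ∘ arcs) orientEdge bidirected

-- Maximum cuts

module MaximumCut (G : Graph n) where

  Mono : Subset n → Rel (Fin n) 0ℓ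
  Mono T x y = Adj G x y × lookup T x ≡ lookup T y

  mono? : ∀ T → Decidable (Mono T)
  mono? T x y = adj? G x y ×-dec lookup T x Bool.≟ lookup T y

  Bichrome : Subset n → Rel (Fin n) 0ℓ
  Bichrome T x y = Adj G x y × lookup T x ≢ lookup T y

  bichrome? : ∀ T → Decidable (Bichrome T)
  bichrome? T x y = adj? G x y ×-dec ¬? (lookup T x Bool.≟ lookup T y)

  mono : Subset n → Pairs n
  mono T = pairs (mono? T)

  -- The number of adjacent pairs is fixed, so fewest monochromatic pairs means most bichromatic
  -- ones.
  maximumCut : ∃[ T ] ∀ T′ → size (mono T) ≤ size (mono T′)
  maximumCut = descent (size ∘ mono) improve full
    where
    improve : ∀ T → (∀ T′ → size (mono T) ≤ size (mono T′)) ⊎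
                    ∃[ T′ ] size (mono T′) < size (mono T)
    improve T with anySubset? (λ T′ → size (mono T′) <? size (mono T))
    ... | yes better = inj₂ better
    ... | no  none   = inj₁ (λ T′ → ≮⇒≥ (none ∘ (T′ ,_)))

  module _ (conn : EdgeConnected 3 G) where

    edge-across : ∀ (F : List (Edge G)) → length F < 3 → ∀ S {u v} → u ∉ S → v ∈ S →
      ∃[ x ] ∃[ y ] x ∉ S × y ∈ S × Adj G x y × ¬ Any (Joins x y) F
    edge-across F F<3 S {u} {v} = crossing S (proj₂ conn F F<3 u v)

    -- At most two edges are ever deleted: `uv`, if it is an edge, and then the crossing edge `ab`
    -- just found. All edges are listed from outside `S` to inside, so comparing `cd` with `ab` in
    -- this order suffices.
    two-edges-across : ∀ S {u v} → u ∉ S → v ∈ S →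
      ∃[ a ] ∃[ b ] ∃[ c ] ∃[ d ]
        (a ∉ S × b ∈ S × Adj G a b × ¬ (a ≡ u × b ≡ v)) ×
        (c ∉ S × d ∈ S × Adj G c d × ¬ (c ≡ u × d ≡ v)) ×
        ¬ (c ≡ a × d ≡ b)
    two-edges-across S {u} {v} u∉S v∈S = choose (adj? G u v)
      where
      avoid : (F : List (Edge G)) → length F < 2 →
        (∀ {x y} → Adj G x y → ¬ Any (Joins x y) F → ¬ (x ≡ u × y ≡ v)) → _
      avoid F F<2 avoids with edge-across F (≤-trans F<2 (s≤s (s≤s z≤n))) S u∉S v∈S
      ... | a , b , a∉S , b∈S , ab , ab∉F with edge-across (edge a b ab ∷ F) (s≤s F<2) S u∉S v∈S
      ...   | c , d , c∉S , d∈S , cd , cd∉F =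
        a , b , c , d , (a∉S , b∈S , ab , avoids ab ab∉F) ,
        (c∉S , d∈S , cd , avoids cd (cd∉F ∘ there)) , cd∉F ∘ here ∘ inj₁

      choose : Dec (Adj G u v) → _
      choose (yes uv) = avoid (edge u v uv ∷ []) (s≤s (s≤s z≤n)) (λ _ ∉F ≡uv → ∉F (here (inj₁ ≡uv)))
      choose (no ¬uv) = avoid [] (s≤s z≤n) λ { xy _ (refl , refl) → ¬uv xy }

    -- Otherwise only `uv` can be bichromatic across `S`. Flipping the sides of the vertices in `S`
    -- then makes at most `uv` monochromatic and two other edges bichromatic, against minimality.
    bichrome-cut : ∀ T → (∀ T′ → size (mono T) ≤ size (mono T′)) → ∀ S {u v} → u ∉ S → v ∈ S →
      ∃[ x ] ∃[ y ] x ∉ S × y ∈ S × Bichrome T x y × ¬ (x ≡ u × y ≡ v)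
    bichrome-cut T minimal S {u} {v} u∉S v∈S
      with any? (λ x → any? (λ y → ¬? (x ∈? S) ×-dec y ∈? S ×-dec bichrome? T x y
                                   ×-dec ¬? (x ≟ u ×-dec y ≟ v)))
    ... | yes found = found
    ... | no  none with two-edges-across S u∉S v∈S
    ...   | a , b , c , d , (a∉S , b∈S , ab , ab≢uv) , (c∉S , d∈S , cd , cd≢uv) , cd≢ab =
      contradiction (minimal T′) (<⇒≱ fewer)
      where
      T′ = zipWith _xor_ T S

      only-uv : ∀ {x y} → x ∉ S → y ∈ S → Bichrome T x y → x ≡ u × y ≡ v
      only-uv {x} {y} x∉S y∈S xy = decidable-stable (x ≟ u ×-dec y ≟ v)
        (λ ≢uv → none (x , y , x∉S , y∈S , xy , ≢uv))

      monochrome : ∀ {x y} → x ∉ S → y ∈ S → Adj G x y → ¬ (x ≡ u × y ≡ v) → Mono T x y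
      monochrome {x} {y} x∉S y∈S xy ≢uv = xy , decidable-stable (lookup T x Bool.≟ lookup T y)
        (λ x≢y → ≢uv (only-uv x∉S y∈S (xy , x≢y)))

      lookup-T′ : ∀ x → lookup T′ x ≡ lookup T x xor lookup S x
      lookup-T′ x = lookup-zipWith _xor_ x T S

      same-side : ∀ {x y} → lookup S x ≡ lookup S y → Mono T′ x y → Mono T x y
      same-side {x} {y} Sx≡Sy (xy , T′x≡T′y) = xy , xor-cancelʳ (lookup S y)
        (subst (λ s → lookup T x xor s ≡ lookup T y xor lookup S y) Sx≡Sy
          (trans (sym (lookup-T′ x)) (trans T′x≡T′y (lookup-T′ y))))

      -- Exactly one end of a crossing edge changes sides.
      flipped : ∀ {x y} → x ∉ S → y ∈ S → Mono T′ x y → Bichrome T x y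
      flipped {x} {y} x∉S y∈S (xy , T′x≡T′y) = xy , λ Tx≡Ty → Bool.not-¬ {lookup T x} refl (trans
        (sym (Bool.xor-identityʳ _)) (trans
        (subst₂ (λ s t → lookup T x xor s ≡ lookup T y xor t) (∉⇒lookup x∉S) ([]=⇒lookup y∈S)
          (trans (sym (lookup-T′ x)) (trans T′x≡T′y (lookup-T′ y))))
        (trans (Bool.xor-comm _ true) (cong not (sym Tx≡Ty)))))

      not-crossing : ∀ {x y} → Mono T′ x y → ¬ (x ≡ u × y ≡ v) → ¬ (x ≡ v × y ≡ u) →
                     (x ∉ S × y ∉ S) ⊎ (x ∈ S × y ∈ S)
      not-crossing {x} {y} (xy , eq) ≢uv ≢vu with x ∈? S | y ∈? S
      ... | no x∉S  | no y∉S  = inj₁ (x∉S , y∉S)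
      ... | yes x∈S | yes y∈S = inj₂ (x∈S , y∈S)
      ... | no x∉S  | yes y∈S = contradiction (only-uv x∉S y∈S (flipped x∉S y∈S (xy , eq))) ≢uv
      ... | yes x∈S | no y∉S  =
        contradiction (swap (only-uv y∉S x∈S (flipped y∉S x∈S (symm G xy , sym eq)))) ≢vu

      remove₂ : Pairs n → Fin n → Fin n → Pairs n
      remove₂ D x y = remove (remove D x y) y x

      -- Apart from `uv`, no monochromatic edge of `T′` crosses `S`, so the flip preserves its
      -- status, and it differs from the crossing edge `ab`.
      remains : ∀ {x y} → remove₂ (mono T′) u v ∋ x ⟶ y → remove₂ (mono T) a b ∋ x ⟶ y
      remains {x} {y} r with remove⁻ (remove (mono T′) u v) r
      ... | r′ , ≢vu with remove⁻ (mono T′) r′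
      ...   | x⟶y , ≢uv with pairs⁻ (mono? T′) x⟶y
      ...     | xy with not-crossing xy ≢uv ≢vu
      ...       | inj₁ (x∉S , y∉S) =
        remove⁺ _ (remove⁺ (mono T)
          (pairs⁺ (mono? T) (same-side (trans (∉⇒lookup x∉S) (sym (∉⇒lookup y∉S))) xy))
          (λ { (refl , refl) → y∉S b∈S })) (λ { (refl , refl) → x∉S b∈S })
      ...       | inj₂ (x∈S , y∈S) =
        remove⁺ _ (remove⁺ (mono T)
          (pairs⁺ (mono? T) (same-side (trans ([]=⇒lookup x∈S) (sym ([]=⇒lookup y∈S))) xy))
          (λ { (refl , refl) → a∉S x∈S })) (λ { (refl , refl) → a∉S y∈S })

      -- The edge `cd` makes the inclusion strict. It is not `ba` either, as `c` lies outside `S`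
      -- and `b` inside.
      cd-remains : remove₂ (mono T) a b ∋ c ⟶ d
      cd-remains = remove⁺ _ (remove⁺ (mono T) (pairs⁺ (mono? T) (monochrome c∉S d∈S cd cd≢uv)) cd≢ab)
        (λ { (refl , refl) → c∉S b∈S })

      cd-flipped : ¬ remove₂ (mono T′) u v ∋ c ⟶ d
      cd-flipped r = cd≢uv (only-uv c∉S d∈S (flipped c∉S d∈S
        (pairs⁻ (mono? T′) (proj₁ (remove⁻ (mono T′) (proj₁ (remove⁻ (remove (mono T′) u v) r)))))))

      ab∈mono : mono T ∋ a ⟶ b
      ab∈mono = pairs⁺ (mono? T) (monochrome a∉S b∈S ab ab≢uv)

      ba∈mono : remove (mono T) a b ∋ b ⟶ a
      ba∈mono = remove⁺ (mono T)
        (pairs⁺ (mono? T) (let (adj , eq) = pairs⁻ (mono? T) ab∈mono in symm G adj , sym eq))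
        (λ { (refl , refl) → a∉S b∈S })

      -- Pairs are ordered, so every edge counts twice.  Flipping S makes at most uv
      -- monochromatic, while ab and cd cease to be.
      fewer : size (mono T′) < size (mono T)
      fewer = begin-strict
        size (mono T′)                         ≤⟨ size-remove-≥ (mono T′) u v ⟩
        1 + size (remove (mono T′) u v)        ≤⟨ s≤s (size-remove-≥ (remove (mono T′) u v) v u) ⟩
        2 + size (remove₂ (mono T′) u v)       <⟨ s≤s (s≤s (size-mono-< _ _ remains cd-remains cd-flipped)) ⟩
        2 + size (remove₂ (mono T) a b)        ≤⟨ s≤s (size-remove-< (remove (mono T) a b) ba∈mono) ⟩
        1 + size (remove (mono T) a b)         ≤⟨ size-remove-< (mono T) ab∈mono ⟩
        size (mono T)                          ∎
        where open ≤-Reasoning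

-- Alternating colourings

-- Loops are erased in the walk of arcs and not in its image in `G`, so that the resulting path
-- stays directed and still alternates.
support : {R : Rel (Fin n) 0ℓ} → ∀ {u v} → Star R u v → List (Fin n)
support {u = u} ε        = u ∷ []
support {u = u} (_ ◅ rs) = u ∷ support rs

vertices-map : ∀ (G : Graph n) {R : Rel (Fin n) 0ℓ} (f : R ⇒ Adj G) {u v} (w : Star R u v) →
               vertices G (Star.map f w) ≡ support w
vertices-map G f ε        = refl
vertices-map G f (r ◅ rs) = cong (_ ∷_) (vertices-map G f rs)

module _ {R : Rel (Fin n) 0ℓ} where

  SimpleWalk : Rel (Fin n) 0ℓ
  SimpleWalk u v = Σ[ w ∈ Star R u v ] Unique (support w)

  suffix : ∀ {x u v} ((w , _) : SimpleWalk u v) → x ∈ˡ support w → SimpleWalk x v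
  suffix (ε      , uniq)     (here refl) = ε , uniq
  suffix (r ◅ rs , uniq)     (here refl) = r ◅ rs , uniq
  suffix (r ◅ rs , _ ∷ uniq) (there x∈)  = suffix (rs , uniq) x∈

  simplify : ∀ {u v} → Star R u v → SimpleWalk u v
  simplify ε = ε , [] ∷ []
  simplify {u} (r ◅ rs) with simplify rs
  ... | w , uniq with Any.any? (u ≟_) (support w)
  ...   | yes u∈w = suffix (w , uniq) u∈w
  ...   | no  u∉w = r ◅ w , ¬Any⇒All¬ _ u∉w ∷ uniq

paint : Bool → Fin 2
paint false = zero
paint true  = suc zero

paint-not : ∀ b → paint b ≢ paint (not b)
paint-not false ()
paint-not true  ()

-- The colour of a step depends only on the vertex it leaves. Hence the first colour of a walk is
-- fixed by its origin and the last by its destination, for forward and backward traversal of arcs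
-- alike.
module Alternating {G : Graph n} (c : Coloring G 2) {R : Rel (Fin n) 0ℓ} (f : R ⇒ Adj G)
  (φ : Fin n → Bool)
  (φ-alternates : ∀ {x y} → R x y → φ y ≡ not (φ x))
  (color-f : ∀ {x y} (r : R x y) → color c (f r) ≡ paint (φ x))
  where

  proper : ∀ {u v} (w : Star R u v) → IsProper c (Star.map f w)
  proper ε            = []
  proper (r ◅ ε)      = [-]
  proper {u} (r ◅ s ◅ rs) = differ ∷ proper (s ◅ rs)
    where
    differ : color c (f r) ≢ color c (f s)
    differ eq = paint-not (φ u) (trans (sym (color-f r)) (trans eq
      (trans (color-f s) (cong paint (φ-alternates r)))))

  head-color : ∀ {u v} → u ≢ v → (w : Star R u v) →
               head (colors c (Star.map f w)) ≡ just (paint (φ u))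
  head-color u≢v ε        = contradiction refl u≢v
  head-color u≢v (r ◅ rs) = cong just (color-f r)

  last-color : ∀ {u v} → u ≢ v → (w : Star R u v) →
               last (colors c (Star.map f w)) ≡ just (paint (not (φ v)))
  last-color u≢v ε        = contradiction refl u≢v
  last-color {v = v} u≢v (r ◅ rs) = last-◅ r rs
    where
    -- The recursion is over walks given as nonempty, since `u ≢ v` does not pass to the tail.
    last-◅ : ∀ {x y} (r : R x y) (rs : Star R y v) →
             last (colors c (Star.map f (r ◅ rs))) ≡ just (paint (not (φ v)))
    last-◅ {x} r ε        = cong just (trans (color-f r) (cong paint
      (sym (trans (cong not (φ-alternates r)) (Bool.not-involutive (φ x))))))
    last-◅     r (s ◅ rs) = last-◅ s rs

  properPath : ∀ {u v} → u ≢ v → Star R u v →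
    Σ[ P ∈ ProperPath c u v ]
      start P ≡ just (paint (φ u)) × end P ≡ just (paint (not (φ v)))
  properPath u≢v w₀ = let (w , simple) = simplify w₀ in
    record { walk     = Star.map f w
           ; isPath   = subst Unique (sym (vertices-map G f w)) simple
           ; isProper = proper w } ,
    head-color u≢v w , last-color u≢v w

-- Colouring edges by the tails of a strong orientation.

module _ {G : Graph n} (T : Subset n) (D : Pairs n)
  (D-bichrome : ∀ {x y} → D ∋ x ⟶ y → Adj G x y × lookup T x ≢ lookup T y)
  (D-antisym  : ∀ {x y} → D ∋ x ⟶ y → ¬ D ∋ y ⟶ x)
  (D-strong   : ∀ u v → Star (D ∋_⟶_) u v)
  where

  tailColor : Fin n → Fin n → Fin 2
  tailColor x y with D ∋ x ⟶? y | D ∋ y ⟶? x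
  ... | yes _ | _     = paint (lookup T x)
  ... | no _  | yes _ = paint (lookup T y)
  -- Default colour of pairs without an arc; the paths are built from arcs alone.
  ... | no _  | no _  = zero

  -- Rests on antisymmetry: two opposite arcs would have tails on different sides and claim
  -- different colours.
  tailColor-sym : ∀ x y → tailColor x y ≡ tailColor y x
  tailColor-sym x y with D ∋ x ⟶? y | D ∋ y ⟶? x
  ... | yes x⟶y | yes y⟶x = contradiction y⟶x (D-antisym x⟶y)
  ... | yes _   | no _    = refl
  ... | no _    | yes _   = refl
  ... | no _    | no _    = refl

  tailColor-arc : ∀ {x y} → D ∋ x ⟶ y → tailColor x y ≡ paint (lookup T x)
  tailColor-arc {x} {y} x⟶y with D ∋ x ⟶? y | D ∋ y ⟶? x
  ... | yes _   | _ = refl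
  ... | no ¬x⟶y | _ = contradiction x⟶y ¬x⟶y

  orientationColoring : Coloring G 2
  orientationColoring = record
    { color     = λ {x} {y} _ → tailColor x y
    ; color-sym = λ {x} {y} _ _ → tailColor-sym x y
    }

  private
    alternates : ∀ {x y} → D ∋ x ⟶ y → lookup T y ≡ not (lookup T x)
    alternates x⟶y = Bool.¬-not (proj₂ (D-bichrome x⟶y) ∘ sym)

    module Forward = Alternating orientationColoring {R = D ∋_⟶_}
      (proj₁ ∘ D-bichrome) (lookup T) alternates tailColor-arc

    -- A backward step leaves the head of its arc, while the colour is that of the tail, on the
    -- other side; hence the negation.
    module Backward = Alternating orientationColoring {R = flip (D ∋_⟶_)}
      (symm G ∘ proj₁ ∘ D-bichrome) (not ∘ lookup T)
      (λ y⟶x → trans (sym (alternates y⟶x)) (sym (Bool.not-involutive _)))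
      (λ {x} {y} y⟶x → trans (tailColor-sym x y) (trans (tailColor-arc y⟶x)
        (cong paint (trans (sym (Bool.not-involutive _)) (cong not (sym (alternates y⟶x)))))))

  strongProperty : HasStrongProperty orientationColoring
  strongProperty = (λ u v u≢v → proj₁ (forward u v u≢v)) , λ u v u≢v →
    let (P₁ , start₁ , end₁) = forward u v u≢v
        (P₂ , start₂ , end₂) = Backward.properPath u≢v (Star.reverse id (D-strong v u))
    in P₁ , P₂ ,
       -- The Boolean left implicit is the side of `u` here, and the negated side of `v` for the
       -- ends.
       (λ eq → paint-not _ (just-injective (trans (sym start₁) (trans eq start₂)))) ,
       (λ eq → paint-not _ (just-injective (trans (sym end₁) (trans eq end₂))))
    where
    forward : ∀ u v → u ≢ v → _
    forward u v u≢v = Forward.properPath u≢v (D-strong u v)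

-- The lower bound on the number of colours.

distinct⇒2≤ : ∀ {t} {i j : Fin t} → i ≢ j → 2 ≤ t
distinct⇒2≤ {1}           {zero} {zero} i≢j = contradiction refl i≢j
distinct⇒2≤ {suc (suc _)}               _   = s≤s (s≤s z≤n)

-- Two consecutive edges of a proper path already exhibit two colours, so with fewer the path is a
-- single edge.
properPath⇒adjacent : ∀ {G : Graph n} {t} (c : Coloring G t) → ¬ 2 ≤ t →
                      ∀ {u v} → u ≢ v → ProperPath c u v → Adj G u v
properPath⇒adjacent c t<2 u≢v P with walk P | isProper P
... | ε         | _            = contradiction refl u≢v
... | e ◅ ε     | _            = e
... | _ ◅ _ ◅ _ | differ ∷ _ = contradiction (distinct⇒2≤ differ) t<2

noncomplete⇒2≤ : ∀ {G : Graph n} → ¬ Complete G →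
                 ∀ t (c : Coloring G t) → ProperConnected c → 2 ≤ t
noncomplete⇒2≤ noncomplete t c conn = decidable-stable (2 ≤? t)
  (λ t<2 → noncomplete (λ u v u≢v → properPath⇒adjacent c t<2 u≢v (conn u v u≢v)))

theorem3p1 : ∀ (n : ℕ) (G : Graph n) → EdgeConnected 3 G → ¬ Complete G →
    IsProperConnectionNumber G 2 × (Σ[ c ∈ Coloring G 2 ] HasStrongProperty c)
theorem3p1 n G conn noncomplete =
  ((c , proj₁ strong) , noncomplete⇒2≤ noncomplete) , c , strong
  where
  open MaximumCut G

  T : Subset n
  T = proj₁ maximumCut

  -- Robbins' theorem is applied to the bichromatic subgraph of the maximum cut `T`.
  open Robbins (bichrome? T) (λ (_ , x≢x) → x≢x refl) (bichrome-cut conn T (proj₂ maximumCut))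

  M : MixedOrientation
  M = proj₁ strongOrientation

  c : Coloring G 2
  c = orientationColoring T (arcs M) (sound M) (proj₂ strongOrientation) (connected M)

  strong : HasStrongProperty c
  strong = strongProperty T (arcs M) (sound M) (proj₂ strongOrientation) (connected M)
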